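{- For every integer $t\ge 3$, if a graph $G$ has a circular drawing whose crossing graph has no $K_t$-minor, then $G$ has treewidth at most $12t-23$.
   Context: A circular drawing of a graph $G$ places the vertices of $G$ at distinct points on a circle and draws each edge as the straight line segment between its endpoints. Two edges cross if their segments intersect at a point that is not an endpoint of either. The crossing graph $X_D$ of a circular drawing $D$ of $G$ is the graph with vertex set $E(G)$ in which two edges are adjacent if and only if they cross in $D$. -}

module Defs where

open import Data.Nat using (ℕ; zero; suc; _≤_; _<_; _⊓_; _⊔_)
open import Data.Fin using (Fin; toℕ) renaming (zero to fzero; suc to fsuc)
open import Data.Fin.Subset using (Subset; _∈_; ∣_∣)
open import Data.Bool using (Bool; true; false)
open import Data.Product using (Σ; ∃; _×_; _,_; proj₁; proj₂)
open import Data.Sum using (_⊎_)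
open import Relation.Nullary using (¬_)
open import Relation.Binary.PropositionalEquality using (_≡_; _≢_)
open import Function.Definitions using (Injective)

record Graph (n : ℕ) : Set where
  field
    adj   : Fin n → Fin n → Bool
    sym   : ∀ u v → adj u v ≡ adj v u
    irrfl : ∀ u → adj u u ≡ false

open Graph public

-- An edge of G: an unordered pair {u,v}, represented as (u , v) with u < v.
Edge : ∀ {n} → Graph n → Set
Edge {n} G = Σ (Fin n × Fin n) λ p → (toℕ (proj₁ p) < toℕ (proj₂ p)) × (adj G (proj₁ p) (proj₂ p) ≡ true)

data Walk {V : Set} (A : V → V → Set) (S : V → Set) : V → V → Set where
  here : ∀ {x} → S x → Walk A S x x
  step : ∀ {x y z} → S x → A x y → Walk A S y z → Walk A S x z

ConnectedSet : {V : Set} → (V → V → Set) → (V → Set) → Set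
ConnectedSet A S = ∀ x y → S x → S y → Walk A S x y

HasCompleteMinor : (t : ℕ) → {V : Set} → (V → V → Set) → Set₁
HasCompleteMinor t {V} A =
  Σ (Fin t → V → Set) λ B →
    (∀ i → ∃ λ x → B i x) ×
    (∀ i j → i ≢ j → ∀ x → B i x → ¬ B j x) ×
    (∀ i → ConnectedSet A (B i)) ×
    (∀ i j → i ≢ j → ∃ λ x → ∃ λ y → B i x × B j y × A x y)

-- Circular drawings.  Only the cyclic order of the vertices on the circle
-- matters for which chords cross; we record it by an injective position
-- map pos : Fin n → ℕ (cutting the circle at a point not used by vertices).

CircularDrawing : ℕ → Set
CircularDrawing n = Σ (Fin n → ℕ) Injective′
  where Injective′ = λ (pos : Fin n → ℕ) → Injective _≡_ _≡_ pos

StrictlyBetween : ℕ → ℕ → ℕ → Set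
StrictlyBetween p q w = (p ⊓ q < w) × (w < p ⊔ q)

-- chords ab and cd cross (at a point that is not an endpoint) iff the
-- four endpoints are distinct and exactly one of c,d lies on the arc
-- strictly between a and b.
Cross : ∀ {n} (G : Graph n) → CircularDrawing n → Edge G → Edge G → Set
Cross G (pos , _) ((a , b) , _) ((c , d) , _) =
  (c ≢ a) × (c ≢ b) × (d ≢ a) × (d ≢ b) ×
  ((StrictlyBetween (pos a) (pos b) (pos c) × ¬ StrictlyBetween (pos a) (pos b) (pos d))
   ⊎ (¬ StrictlyBetween (pos a) (pos b) (pos c) × StrictlyBetween (pos a) (pos b) (pos d)))

-- The crossing graph X_D has vertex set E(G), adjacency = Cross.

-- Tree decompositions.  A finite tree on node set Fin (suc m) is given by
-- parent pointers: node (fsuc i) has parent (par i) with a smaller index.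

record Tree : Set where
  field
    m      : ℕ
    par    : Fin m → Fin (suc m)
    par<   : ∀ i → toℕ (par i) < toℕ (fsuc {m} i)

TreeAdj : (T : Tree) → Fin (suc (Tree.m T)) → Fin (suc (Tree.m T)) → Set
TreeAdj T x y =
  (Σ (Fin (Tree.m T)) λ i → (x ≡ fsuc i) × (y ≡ Tree.par T i)) ⊎
  (Σ (Fin (Tree.m T)) λ i → (y ≡ fsuc i) × (x ≡ Tree.par T i))

record TreeDecomposition {n : ℕ} (G : Graph n) (k : ℕ) : Set where
  field
    tree   : Tree
    bag    : Fin (suc (Tree.m tree)) → Subset n
    width  : ∀ x → ∣ bag x ∣ ≤ suc k
    cover  : ∀ v → ∃ λ x → v ∈ bag x
    edges  : ∀ u v → adj G u v ≡ true → ∃ λ x → (u ∈ bag x) × (v ∈ bag x)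
    conn   : ∀ v → ConnectedSet (TreeAdj tree) (λ x → v ∈ bag x)

TreewidthAtMost : ∀ {n} → Graph n → ℕ → Set
TreewidthAtMost G k = TreeDecomposition G k

{-# OPTIONS --safe #-}

-- Put the vertices on a line, let d = t − 1, and call an interval [x , y] thin if at most 2d edges join
-- its interior to its complement.  Every thin interval has an interior point z such that [x , z] and
-- [z , y] are thin.  To see this, regard an edge inside [x , y] as the open interval it spans, extend the
-- d leaving edges whose inner ends are leftmost to x, and extend the other leaving edges to y.  If every
-- interior point were covered at least t times, these open intervals would contain t disjoint covers of
-- the interior; each can be thinned out to a chain of consecutively crossing edges, and any two covers
-- cross, so the crossing graph would have a K_t-minor.  Hence some z is covered at most d times, which
-- leaves at most d + d edges across each of the two halves.  Splitting recursively gives a tree of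
-- intervals, and the inner ends of the edges leaving a half together with x, y, z are the bags; they
-- have at most 4d + 3 ≤ 12t − 22 vertices.
module Submission where

open import Defs
open import Data.Nat using (ℕ; _≤_; _*_; _∸_)
open import Data.Product using (Σ)
open import Relation.Nullary using (¬_)

open import Axiom.UniquenessOfIdentityProofs using (module Decidable⇒UIP)
open import Data.Bool using (true; false)
open import Data.Empty using (⊥-elim)
open import Data.Fin using (Fin; toℕ; fromℕ; inject₁) renaming (zero to fzero; suc to fsuc)
open import Data.Fin.Properties using (toℕ<n; toℕ-fromℕ; toℕ-inject₁; toℕ-injective; any?)
open import Data.Fin.Relation.Unary.Top using (view; ‵fromℕ; ‵inject₁)
open import Data.Fin.Subset using (Subset; ⁅_⁆; _∪_; ∣_∣) renaming (_∈_ to _∈ˢ_; ⊥ to ∅)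
open import Data.Fin.Subset.Properties using (∉⊥; x∈⁅x⁆; x∈⁅y⁆⇒x≡y; x∈p∪q⁻; p⊆p∪q; q⊆p∪q; ∣⊥∣≡0; ∣⁅x⁆∣≡1)
open import Data.List using (List; []; _∷_; _++_; map; filter; length; foldr; take; drop; allFin; cartesianProduct)
open import Data.List.Extrema.Nat using (argmax; argmax-all; f[⊥]≤f[argmax]; f[xs]≤f[argmax])
open import Data.List.Membership.Propositional using (_∈_; lose)
open import Data.List.Membership.Propositional.Properties using (∈-filter⁺; ∈-filter⁻; ∈-map⁺; ∈-map⁻; ∈-++⁺ˡ; ∈-++⁺ʳ; ∈-++⁻; ∈-∃++; ∈-allFin; ∈-cartesianProduct⁺)
open import Data.List.Properties using (filter-accept; filter-reject; filter-++; filter-some; map-++; length-++; length-map; length-take; length-drop; take++drop≡id)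
open import Data.List.Relation.Binary.Permutation.Propositional using (_↭_; ↭-refl; ↭-sym; ↭-trans; prep; ↭⇒↭ₛ)
open import Data.List.Relation.Binary.Permutation.Propositional.Properties using (shift; filter-↭; ↭-length; ∈-resp-↭) renaming (map⁺ to map-↭)
open import Data.List.Relation.Unary.All as All using (All; []; _∷_)
open import Data.List.Relation.Unary.All.Properties using (all-filter)
open import Data.List.Relation.Unary.AllPairs using (AllPairs; []; _∷_)
open import Data.List.Relation.Unary.Any using (here; there)
open import Data.List.Relation.Unary.Unique.Propositional using (Unique)
open import Data.Nat using (zero; suc; _+_; _⊔_; _<_; z≤n; s≤s; s≤s⁻¹; _<?_; _≤?_; _≟_)
open import Data.Nat.Properties using (≤-refl; ≤-trans; ≤-reflexive; ≤-antisym; ≤-total; <-trans; <-asym; <-irrefl; <-cmp; <-≤-trans; ≤-<-trans; <⇒≤; <⇒≢; <⇒≱; ≮⇒≥; ≰⇒>; n<1+n; n≤1+n; m<n⇒m<1+n; n≢0⇒n>0; m≤m+n; +-suc; +-identityʳ; +-mono-≤; +-monoʳ-≤; m+n∸m≡n; m≤n+o⇒m∸n≤o; ⊓-comm; ⊔-comm; m⊓n≤m; m≤m⊔n; m≤n⊔m; m≤n⇒m⊓n≡m; m≤n⇒m⊔n≡n; anyUpTo?; ≤-decTotalOrder)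
open import Data.Nat.Tactic.RingSolver using (solve-∀)
open import Data.Product using (∃; ∃₂; _×_; _,_; proj₁; proj₂; swap)
open import Data.Sum using (_⊎_; inj₁; inj₂; [_,_]′; fromInj₂)
open import Data.Vec using ([]; _∷_)
open import Function using (_∘_; case_of_)
open import Function.Definitions using (Injective)
open import Relation.Binary using (tri<; tri≈; tri>)
open import Relation.Binary.Bundles using (DecTotalOrder)
open import Relation.Binary.PropositionalEquality using (_≡_; _≢_; refl; trans; cong; cong₂; subst; subst₂; setoid) renaming (sym to ≡-sym)
open import Relation.Nullary using (yes; no)
open import Relation.Nullary.Decidable using (_×-dec_; _⊎-dec_)
open import Relation.Unary using (Decidable)
import Data.Bool.Properties as Bool
import Data.List.Relation.Binary.Permutation.Setoid.Properties as Permₛ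
import Data.List.Relation.Unary.Sorted.TotalOrder.Properties as Sorted
import Data.List.Relation.Unary.Unique.Propositional.Properties as Unique
import Data.List.Sort as Sort
import Data.Sum as Sum
import Relation.Binary.Construct.On as On
open Decidable⇒UIP Bool._≟_ using (≡-irrelevant)

-- Walks, maximisers and permutations of lists

private
  variable
    A : Set

_++ʷ_ : {V : Set} {R : V → V → Set} {S : V → Set} {x y z : V} →
        Walk R S x y → Walk R S y z → Walk R S x z
here _ ++ʷ w = w
step s a v ++ʷ w = step s a (v ++ʷ w)

walk-mono : {V : Set} {R : V → V → Set} {S S′ : V → Set} → (∀ {x} → S x → S′ x) →
            ∀ {x y} → Walk R S x y → Walk R S′ x y
walk-mono S⊆S′ (here s) = here (S⊆S′ s)
walk-mono S⊆S′ (step s a w) = step (S⊆S′ s) a (walk-mono S⊆S′ w)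

-- Supplies every greedy choice below. Non-emptiness is asked for as a positive length because lower
-- bounds on `depth` have that form.
maximiser : {P : A → Set} (P? : Decidable P) (f : A → ℕ) (xs : List A) →
            0 < length (filter P? xs) →
            ∃ λ c → c ∈ xs × P c × (∀ {x} → x ∈ xs → P x → f x ≤ f c)
maximiser P? f xs pos with filter P? xs in eq
maximiser P? f xs () | []
maximiser P? f xs _ | y ∷ ys =
  c , proj₁ (∈-filter⁻ P? c∈) , proj₂ (∈-filter⁻ P? {xs = xs} c∈) , λ x∈ Px → max (subst (_ ∈_) eq (∈-filter⁺ P? x∈ Px))
  where
  c = argmax f y ys
  c∈ : c ∈ filter P? xs
  c∈ = subst (c ∈_) (≡-sym eq) (argmax-all f {P = _∈ y ∷ ys} (here refl) (All.tabulate there))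
  max : ∀ {x} → x ∈ y ∷ ys → f x ≤ f c
  max (here refl) = f[⊥]≤f[argmax] {f = f} y ys
  max (there x∈) = All.lookup (f[xs]≤f[argmax] {f = f} y ys) x∈

∈⇒↭∷ : {x : A} {xs : List A} → x ∈ xs → ∃ λ ys → xs ↭ x ∷ ys
∈⇒↭∷ x∈ with ys , zs , refl ← ∈-∃++ x∈ = ys ++ zs , shift _ ys zs

AllPairs-++⁻ : {R : A → A → Set} (xs : List A) {ys : List A} → AllPairs R (xs ++ ys) →
               ∀ {x y} → x ∈ xs → y ∈ ys → R x y
AllPairs-++⁻ (x ∷ xs) (rx ∷ _) (here refl) y∈ = All.lookup rx (∈-++⁺ʳ xs y∈)
AllPairs-++⁻ (x ∷ xs) (_ ∷ rs) (there x∈) y∈ = AllPairs-++⁻ xs rs x∈ y∈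

AllPairs-++⁻ʳ : {R : A → A → Set} (xs : List A) {ys : List A} → AllPairs R (xs ++ ys) → AllPairs R ys
AllPairs-++⁻ʳ [] rs = rs
AllPairs-++⁻ʳ (_ ∷ xs) (_ ∷ rs) = AllPairs-++⁻ʳ xs rs

Unique-resp-↭ : {xs ys : List A} → xs ↭ ys → Unique xs → Unique ys
Unique-resp-↭ p = Permₛ.Unique-resp-↭ (setoid _) (↭⇒↭ₛ p)

-- Families of open intervals

-- The label `chord` is kept apart from the end points: extending an edge that leaves the interval
-- changes the open interval it stands for, but not the edge.
record Arc (C : Set) : Set where
  constructor arc
  field
    chord : C
    left right : ℕ

open Arc

module _ {C : Set} where

  Covers : ℕ → Arc C → Set
  Covers p α = left α < p × p < right α

  covers? : ∀ p → Decidable (Covers p)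
  covers? p α = (left α <? p) ×-dec (p <? right α)

  depth : List (Arc C) → ℕ → ℕ
  depth F p = length (filter (covers? p) F)

  -- The range is half-open, so the interior of [x , y] runs from `suc x`, and what an open arc c
  -- leaves uncovered starts at `right c` itself.
  CoversRange : ℕ → ℕ → List (Arc C) → Set
  CoversRange b y F = ∀ p → b ≤ p → p < y → ∃ λ α → α ∈ F × Covers p α

  depth-++ : ∀ F H p → depth (F ++ H) p ≡ depth F p + depth H p
  depth-++ F H p = trans (cong length (filter-++ (covers? p) F H)) (length-++ (filter (covers? p) F))

  depth-↭ : ∀ {F H} → F ↭ H → ∀ p → depth F p ≡ depth H p
  depth-↭ F↭H p = ↭-length (filter-↭ (covers? p) F↭H)

  depth-∷-covers : ∀ {p} α F → Covers p α → depth (α ∷ F) p ≡ suc (depth F p)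
  depth-∷-covers {p} α F cov = cong length (filter-accept (covers? p) cov)

  depth-∷-misses : ∀ {p} α F → ¬ Covers p α → depth (α ∷ F) p ≡ depth F p
  depth-∷-misses {p} α F ncov = cong length (filter-reject (covers? p) ncov)

  depth≢0 : ∀ {F p} → (∃ λ α → α ∈ F × Covers p α) → depth F p ≢ 0
  depth≢0 {p = p} (α , α∈F , covα) ≡0 = <⇒≱ (filter-some (covers? p) (lose α∈F covα)) (≤-reflexive ≡0)

  depth-∷-≤ : ∀ {p} α F → depth F p ≤ depth (α ∷ F) p
  depth-∷-≤ {p} α F with covers? p α
  ... | yes cov = ≤-trans (<⇒≤ (n<1+n _)) (≤-reflexive (≡-sym (depth-∷-covers α F cov)))
  ... | no ncov = ≤-reflexive (≡-sym (depth-∷-misses α F ncov))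

  depth-mono : ∀ {p q} F → (∀ {α} → α ∈ F → Covers p α → Covers q α) → depth F p ≤ depth F q
  depth-mono [] _ = z≤n
  depth-mono {p} {q} (α ∷ F) sub with covers? p α
  ... | yes cov = ≤-trans (≤-reflexive (depth-∷-covers α F cov))
                    (≤-trans (s≤s (depth-mono F (sub ∘ there)))
                      (≤-reflexive (≡-sym (depth-∷-covers α F (sub (here refl) cov)))))
  ... | no ncov = ≤-trans (≤-reflexive (depth-∷-misses α F ncov))
                    (≤-trans (depth-mono F (sub ∘ there)) (depth-∷-≤ α F))

  -- Always taking the arc that starts last among those covering the first uncovered point p:
  -- wherever it overlaps earlier choices, every arc covering p is present as well.
  peel-cover : ∀ fuel t F {b y} → y ≤ fuel + b → (∀ p → b ≤ p → p < y → suc t ≤ depth F p) →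
               ∃₂ λ Q R → (F ↭ Q ++ R) × CoversRange b y Q × (∀ s → s < y → depth Q s ≡ 0 ⊎ t ≤ depth R s)
  peel-cover zero t F y≤b deep =
    [] , F , ↭-refl , (λ p b≤p p<y → ⊥-elim (<⇒≱ p<y (≤-trans y≤b b≤p))) , λ _ _ → inj₁ refl
  peel-cover (suc fuel) t F {b} {y} y≤ deep with b <? y
  ... | no b≮y =
    [] , F , ↭-refl , (λ p b≤p p<y → ⊥-elim (b≮y (≤-<-trans b≤p p<y))) , λ _ _ → inj₁ refl
  ... | yes b<y
    with c , c∈F , (lc<b , b<rc) , latest ← maximiser (covers? b) left F (≤-trans (s≤s z≤n) (deep b ≤-refl b<y))
    with F₁ , F↭ ← ∈⇒↭∷ c∈F
    with Q , R , F₁↭ , cov , ok ← peel-cover fuel t F₁ {right c} {y}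
           (≤-trans y≤ (≤-trans (≤-reflexive (≡-sym (+-suc fuel b))) (+-monoʳ-≤ fuel b<rc)))
           (λ p rc≤p p<y → ≤-trans (deep p (≤-trans (<⇒≤ b<rc) rc≤p) p<y)
             (≤-reflexive (trans (depth-↭ F↭ p) (depth-∷-misses c F₁ (λ (_ , p<rc) → <⇒≱ p<rc rc≤p)))))
    = c ∷ Q , R , ↭-trans F↭ (prep c F₁↭) , cover , balance
    where
    cover : CoversRange b y (c ∷ Q)
    cover p b≤p p<y with p <? right c
    ... | yes p<rc = c , here refl , <-≤-trans lc<b b≤p , p<rc
    ... | no p≮rc with α , α∈Q , covα ← cov p (≮⇒≥ p≮rc) p<y = α , there α∈Q , covα
    -- For s < b in c, an arc over b starts no later than c, hence before s, and ends after b, hence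
    -- after s. So the depth at s is at least the depth at b.
    deep-at : ∀ s → Covers s c → s < y → suc t ≤ depth F s
    deep-at s (lc<s , s<rc) s<y with s <? b
    ... | no s≮b = deep s (≮⇒≥ s≮b) s<y
    ... | yes s<b = ≤-trans (deep b ≤-refl b<y)
      (depth-mono F λ α∈ (lα<b , b<rα) → ≤-<-trans (latest α∈ (lα<b , b<rα)) lc<s , <-trans s<b b<rα)
    -- The invariant is kept for all s < y, also below b, since arcs chosen later may reach back
    -- over points of c. Where c alone is removed, depth `suc t` drops to t; where Q already had
    -- arcs, the recursive call guarantees t.
    balance : ∀ s → s < y → depth (c ∷ Q) s ≡ 0 ⊎ t ≤ depth R s
    balance s s<y with ok s s<y | covers? s c
    ... | inj₂ t≤ | _ = inj₂ t≤
    ... | inj₁ Q≡0 | no s∉c = inj₁ (trans (depth-∷-misses c Q s∉c) Q≡0)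
    ... | inj₁ Q≡0 | yes s∈c = inj₂ (s≤s⁻¹ (≤-trans (deep-at s s∈c s<y) (≤-reflexive
      (trans (depth-↭ F↭ s) (trans (depth-∷-covers c F₁ s∈c) (cong suc
        (trans (depth-↭ F₁↭ s) (trans (depth-++ Q R s) (cong (_+ depth R s) Q≡0)))))))))

  -- Induction on t with one cover Q peeled off each time. Q has non-zero depth on the whole range,
  -- so the alternative left by `peel-cover` is that the remainder R is still t deep there. Labels
  -- of Q and R differ because no label of F repeats.
  disjoint-covers : ∀ t F {b y} → Unique (map chord F) → (∀ p → b ≤ p → p < y → t ≤ depth F p) →
                    Σ (Fin t → List (Arc C)) λ Q →
                      (∀ i → CoversRange b y (Q i)) ×
                      (∀ i {α} → α ∈ Q i → α ∈ F) ×
                      (∀ i j → i ≢ j → ∀ {α β} → α ∈ Q i → β ∈ Q j → chord α ≢ chord β)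
  disjoint-covers zero F unique deep = (λ ()) , (λ ()) , (λ ()) , λ ()
  disjoint-covers (suc t) F {b} {y} unique deep
    with Q , R , F↭ , cov , ok ← peel-cover y t F {b} {y} (m≤m+n y b) deep
    with unique′ ← subst Unique (map-++ chord Q R) (Unique-resp-↭ (map-↭ chord F↭) unique)
    with Qs , covs , sub , disj ← disjoint-covers t R {b} {y} (AllPairs-++⁻ʳ (map chord Q) unique′)
           (λ p b≤p p<y → fromInj₂ (λ ≡0 → ⊥-elim (depth≢0 (cov p b≤p p<y) ≡0)) (ok p p<y))
    = (λ { fzero → Q ; (fsuc i) → Qs i })
    , (λ { fzero → cov ; (fsuc i) → covs i })
    , (λ { fzero α∈ → ∈-resp-↭ (↭-sym F↭) (∈-++⁺ˡ α∈)
         ; (fsuc i) α∈ → ∈-resp-↭ (↭-sym F↭) (∈-++⁺ʳ Q (sub i α∈)) })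
    , λ { fzero fzero i≢j → ⊥-elim (i≢j refl)
        ; fzero (fsuc j) _ α∈ β∈ → first-rest α∈ (sub j β∈)
        ; (fsuc i) fzero _ α∈ β∈ → first-rest β∈ (sub i α∈) ∘ ≡-sym
        ; (fsuc i) (fsuc j) i≢j α∈ β∈ → disj i j (i≢j ∘ cong fsuc) α∈ β∈ }
    where
    first-rest : ∀ {α β} → α ∈ Q → β ∈ R → chord α ≢ chord β
    first-rest α∈ β∈ = AllPairs-++⁻ (map chord Q) unique′ (∈-map⁺ chord α∈) (∈-map⁺ chord β∈)

-- From deep families of arcs to complete minors

module _ {C V : Set} (Cr : V → V → Set) (edge : C → V) where

  private
    e : Arc C → V
    e α = edge (chord α)

    On : List (Arc C) → V → Set
    On L v = ∃ λ α → α ∈ L × e α ≡ v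

  -- Only properly overlapping arcs have to cross, not nested ones. Both directions are asked for
  -- because `Cr` is an arbitrary relation and walks are needed both ways.
  CrossingFamily : List (Arc C) → Set
  CrossingFamily F = ∀ {α β} → α ∈ F → β ∈ F → left α < left β → left β < right α → right α < right β →
                     Cr (e α) (e β) × Cr (e β) (e α)

  -- Always taking the arc that reaches farthest makes consecutive arcs overlap properly.
  connected-subcover : ∀ fuel Q {b y} → CrossingFamily Q → (c : Arc C) → c ∈ Q → Covers b c →
    (∀ {α} → α ∈ Q → Covers b α → right α ≤ right c) → CoversRange b y Q → y ≤ fuel + right c →
    ∃ λ L → (∀ {α} → α ∈ L → α ∈ Q) × CoversRange b y L × On L (e c) ×
            (∀ {α} → α ∈ L → Walk Cr (On L) (e c) (e α) × Walk Cr (On L) (e α) (e c))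
  connected-subcover zero Q {b} {y} cr c c∈ (lc<b , b<rc) far cov y≤ =
    c ∷ [] , (λ { (here refl) → c∈ }) ,
    (λ p b≤p p<y → c , here refl , <-≤-trans lc<b b≤p , <-≤-trans p<y y≤) ,
    (c , here refl , refl) ,
    λ { (here refl) → here (c , here refl , refl) , here (c , here refl , refl) }
  connected-subcover (suc fuel) Q {b} {y} cr c c∈ (lc<b , b<rc) far cov y≤ with right c <? y
  ... | no rc≮y = connected-subcover zero Q cr c c∈ (lc<b , b<rc) far cov (≮⇒≥ rc≮y)
  ... | yes rc<y
    -- The open arc c misses its own right end, so the next arc is taken among those over `right c`.
    with α , α∈ , covα ← cov (right c) (<⇒≤ b<rc) rc<y
    with c′ , c′∈ , (lc′<rc , rc<rc′) , far′ ← maximiser (covers? (right c)) right Q (filter-some (covers? (right c)) (lose α∈ covα))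
    with L , sub , covL , c′∈L , walks ← connected-subcover fuel Q {right c} {y} cr c′ c′∈ (lc′<rc , rc<rc′) far′
           (λ p rc≤p → cov p (≤-trans (<⇒≤ b<rc) rc≤p))
           (≤-trans y≤ (≤-trans (≤-reflexive (≡-sym (+-suc fuel (right c)))) (+-monoʳ-≤ fuel rc<rc′)))
    = c ∷ L , (λ { (here refl) → c∈ ; (there α∈) → sub α∈ }) , cover , first , walks′
    where
    first : On (c ∷ L) (e c)
    first = c , here refl , refl
    weaken : ∀ {v} → On L v → On (c ∷ L) v
    weaken (α , α∈ , eq) = α , there α∈ , eq
    cover : CoversRange b y (c ∷ L)
    cover p b≤p p<y with p <? right c
    ... | yes p<rc = c , here refl , <-≤-trans lc<b b≤p , p<rc
    ... | no p≮rc with α , α∈ , covα ← covL p (≮⇒≥ p≮rc) p<y = α , there α∈ , covα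
    -- If c′ started no later than c, it would cover b and reach beyond c, against the choice of c
    -- as farthest-reaching.
    lc<lc′ : left c < left c′
    lc<lc′ = ≰⇒> λ lc′≤lc → <⇒≱ rc<rc′ (far c′∈ (≤-<-trans lc′≤lc lc<b , <-trans b<rc rc<rc′))
    crosses : Cr (e c) (e c′) × Cr (e c′) (e c)
    crosses = cr c∈ c′∈ lc<lc′ lc′<rc rc<rc′
    walks′ : ∀ {α} → α ∈ c ∷ L → Walk Cr (On (c ∷ L)) (e c) (e α) × Walk Cr (On (c ∷ L)) (e α) (e c)
    walks′ (here refl) = here first , here first
    walks′ (there α∈) with to , from ← walks α∈ =
      step first (proj₁ crosses) (walk-mono weaken to) ,
      (walk-mono weaken from ++ʷ step (weaken c′∈L) (proj₂ crosses) (here first))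

  -- The point `right c′` lies in the range by `proper`, so some γ of P passes over it. If γ began
  -- at x or earlier it would cover `suc x`, and so end by `right c` and hence by `right c′`, which
  -- it does not. Thus γ begins after c′ does, and the two overlap properly.
  longer-meets : ∀ F {x y} → suc x < y → CrossingFamily F → (∀ {α} → α ∈ F → left α ≤ x → right α < y) →
                 ∀ P → (∀ {α} → α ∈ P → α ∈ F) → CoversRange (suc x) y P → ∀ {c c′ : Arc C} →
                 (∀ {α} → α ∈ P → Covers (suc x) α → right α ≤ right c) →
                 c′ ∈ F → Covers (suc x) c′ → right c ≤ right c′ →
                 ∃ λ γ → γ ∈ P × Cr (e c′) (e γ) × Cr (e γ) (e c′)
  longer-meets F {x} {y} x+1<y cr proper P sub cov {c} {c′} far c′∈ (lc′≤x , x+1<rc′) rc≤rc′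
    with γ , γ∈ , (lγ<rc′ , rc′<rγ) ← cov (right c′) (<⇒≤ x+1<rc′) (proper c′∈ (s≤s⁻¹ lc′≤x))
    with x <? left γ
  ... | yes x<lγ = γ , γ∈ , cr c′∈ (sub γ∈) (<-≤-trans lc′≤x x<lγ) lγ<rc′ rc′<rγ
  ... | no x≮lγ = ⊥-elim (<⇒≱ rc′<rγ (≤-trans (far γ∈ (s≤s (≮⇒≥ x≮lγ) , <-trans x+1<rc′ rc′<rγ)) rc≤rc′))

  -- In each cover take the arc over `suc x` that reaches farthest; whichever of the two reaches at
  -- least as far crosses an arc of the other cover by `longer-meets`.
  covers-cross : ∀ F {x y} → suc x < y → CrossingFamily F → (∀ {α} → α ∈ F → left α ≤ x → right α < y) →
                 ∀ Q Q′ → (∀ {α} → α ∈ Q → α ∈ F) → (∀ {α} → α ∈ Q′ → α ∈ F) →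
                 CoversRange (suc x) y Q → CoversRange (suc x) y Q′ →
                 ∃₂ λ α β → α ∈ Q × β ∈ Q′ × Cr (e α) (e β)
  covers-cross F {x} {y} x+1<y cr proper Q Q′ sub sub′ cov cov′
    with α , α∈ , covα ← cov (suc x) ≤-refl x+1<y
    with c , c∈ , covc , far ← maximiser (covers? (suc x)) right Q (filter-some (covers? (suc x)) (lose α∈ covα))
    with β , β∈ , covβ ← cov′ (suc x) ≤-refl x+1<y
    with c′ , c′∈ , covc′ , far′ ← maximiser (covers? (suc x)) right Q′ (filter-some (covers? (suc x)) (lose β∈ covβ))
    with ≤-total (right c) (right c′)
  ... | inj₁ rc≤rc′ with γ , γ∈ , crs ← longer-meets F x+1<y cr proper Q sub cov {c} {c′} far (sub′ c′∈) covc′ rc≤rc′ =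
        γ , c′ , γ∈ , c′∈ , proj₂ crs
  ... | inj₂ rc′≤rc with γ , γ∈ , crs ← longer-meets F x+1<y cr proper Q′ sub′ cov′ {c′} {c} far′ (sub c∈) covc rc′≤rc =
        c , γ , c∈ , γ∈ , proj₁ crs

  -- The branch sets are connected subcovers of t label-disjoint covers. Injectivity of the edge map
  -- on labels keeps them disjoint as sets of vertices of `Cr`, and since each is itself a cover,
  -- any two touch.
  deep-family⇒minor : ∀ t F {x y} → suc x < y → Unique (map chord F) →
    (∀ {α β} → α ∈ F → β ∈ F → e α ≡ e β → chord α ≡ chord β) →
    CrossingFamily F → (∀ {α} → α ∈ F → left α ≤ x → right α < y) →
    (∀ p → suc x ≤ p → p < y → t ≤ depth F p) → HasCompleteMinor t Cr
  deep-family⇒minor t F {x} {y} x+1<y unique inj cr proper deep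
    with Q , cov , sub , disj ← disjoint-covers t F unique deep
    = (λ i → On (L i)) , nonempty , disjoint , connected , touching
    where
    subcover : ∀ i → ∃₂ λ c L → (∀ {α} → α ∈ L → α ∈ Q i) × CoversRange (suc x) y L × On L (e c) ×
                 (∀ {α} → α ∈ L → Walk Cr (On L) (e c) (e α) × Walk Cr (On L) (e α) (e c))
    subcover i
      with α , α∈ , covα ← cov i (suc x) ≤-refl x+1<y
      with c , c∈ , covc , far ← maximiser (covers? (suc x)) right (Q i) (filter-some (covers? (suc x)) (lose α∈ covα))
      = c , connected-subcover y (Q i) (λ α∈ β∈ → cr (sub i α∈) (sub i β∈)) c c∈ covc far (cov i) (m≤m+n y (right c))
    L : Fin t → List (Arc C)
    L i = proj₁ (proj₂ (subcover i))
    L⊆Q : ∀ i {α} → α ∈ L i → α ∈ Q i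
    L⊆Q i = proj₁ (proj₂ (proj₂ (subcover i)))
    nonempty : ∀ i → ∃ λ v → On (L i) v
    nonempty i = _ , proj₁ (proj₂ (proj₂ (proj₂ (proj₂ (subcover i)))))
    disjoint : ∀ i j → i ≢ j → ∀ v → On (L i) v → ¬ On (L j) v
    disjoint i j i≢j v (α , α∈ , refl) (β , β∈ , eβ≡v) =
      disj i j i≢j (L⊆Q i α∈) (L⊆Q j β∈)
        (inj (sub i (L⊆Q i α∈)) (sub j (L⊆Q j β∈)) (≡-sym eβ≡v))
    connected : ∀ i → ConnectedSet Cr (On (L i))
    connected i v w (α , α∈ , refl) (β , β∈ , refl)
      with walks ← proj₂ (proj₂ (proj₂ (proj₂ (proj₂ (subcover i)))))
      = proj₂ (walks α∈) ++ʷ proj₁ (walks β∈)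
    touching : ∀ i j → i ≢ j → ∃ λ v → ∃ λ w → On (L i) v × On (L j) w × Cr v w
    touching i j _
      with α , β , α∈ , β∈ , crs ← covers-cross F x+1<y cr proper (L i) (L j)
             (λ α∈ → sub i (L⊆Q i α∈)) (λ α∈ → sub j (L⊆Q j α∈))
             (proj₁ (proj₂ (proj₂ (proj₂ (subcover i))))) (proj₁ (proj₂ (proj₂ (proj₂ (subcover j)))))
      = e α , e β , (α , α∈ , refl) , (β , β∈ , refl) , crs

-- Growing a tree decomposition leaf by leaf

-- Parents in a `Tree` have smaller indices than their children, so a new leaf takes the last index.
-- Maps on nodes are therefore extended at the end, and old nodes are embedded by `inject₁`.
snoc : {A : Set} {m : ℕ} → (Fin m → A) → A → Fin (suc m) → A
snoc {m = zero} f a _ = a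
snoc {m = suc m} f a fzero = f fzero
snoc {m = suc m} f a (fsuc i) = snoc (f ∘ fsuc) a i

snoc-inject₁ : {A : Set} {m : ℕ} (f : Fin m → A) (a : A) (i : Fin m) → snoc f a (inject₁ i) ≡ f i
snoc-inject₁ f a fzero = refl
snoc-inject₁ f a (fsuc i) = snoc-inject₁ (f ∘ fsuc) a i

snoc-last : {A : Set} {m : ℕ} (f : Fin m → A) (a : A) → snoc f a (fromℕ m) ≡ a
snoc-last {m = zero} f a = refl
snoc-last {m = suc m} f a = snoc-last (f ∘ fsuc) a

Node : Tree → Set
Node T = Fin (suc (Tree.m T))

module _ (T : Tree) (p : Node T) where
  open Tree T

  addLeaf : Tree
  addLeaf = record { m = suc m ; par = par′ ; par< = par′< }
    where
    par′ : Fin (suc m) → Fin (suc (suc m))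
    par′ = snoc (inject₁ ∘ par) (inject₁ p)
    par′< : ∀ i → toℕ (par′ i) < toℕ (fsuc {suc m} i)
    par′< i with view i
    ... | ‵fromℕ rewrite snoc-last (inject₁ ∘ par) (inject₁ p) | toℕ-inject₁ p | toℕ-fromℕ m = toℕ<n p
    ... | ‵inject₁ j rewrite snoc-inject₁ (inject₁ ∘ par) (inject₁ p) j | toℕ-inject₁ (par j) | toℕ-inject₁ j = par< j

  leaf : Node addLeaf
  leaf = fromℕ (suc m)

  leaf-parent : TreeAdj addLeaf leaf (inject₁ p)
  leaf-parent = inj₁ (fromℕ m , refl , ≡-sym (snoc-last (inject₁ ∘ par) (inject₁ p)))

  parent-leaf : TreeAdj addLeaf (inject₁ p) leaf
  parent-leaf = inj₂ (fromℕ m , refl , ≡-sym (snoc-last (inject₁ ∘ par) (inject₁ p)))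

  inject₁-adj : ∀ {a b} → TreeAdj T a b → TreeAdj addLeaf (inject₁ a) (inject₁ b)
  inject₁-adj (inj₁ (i , refl , refl)) = inj₁ (inject₁ i , refl , ≡-sym (snoc-inject₁ (inject₁ ∘ par) (inject₁ p) i))
  inject₁-adj (inj₂ (i , refl , refl)) = inj₂ (inject₁ i , refl , ≡-sym (snoc-inject₁ (inject₁ ∘ par) (inject₁ p) i))

-- A tree decomposition under construction: vertices and edges may still be uncovered, but
-- connectivity holds at every stage. Here w bounds the bag size itself, one more than the width.
record TreeOfBags (n w : ℕ) : Set where
  field
    tree  : Tree
    bag   : Node tree → Subset n
    width : ∀ a → ∣ bag a ∣ ≤ w
    conn  : ∀ v → ConnectedSet (TreeAdj tree) (λ a → v ∈ˢ bag a)

  Occurs : Fin n → Set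
  Occurs v = ∃ λ a → v ∈ˢ bag a

  Together : Fin n → Fin n → Set
  Together u v = ∃ λ a → u ∈ˢ bag a × v ∈ˢ bag a

open TreeOfBags

singleBag : ∀ {n w} (S : Subset n) → ∣ S ∣ ≤ w → TreeOfBags n w
singleBag S small = record
  { tree = record { m = 0 ; par = λ () ; par< = λ () }
  ; bag = λ _ → S
  ; width = λ _ → small
  ; conn = λ { v fzero fzero v∈ _ → here v∈ }
  }

module _ {n w : ℕ} (P : TreeOfBags n w) (p : Node (tree P)) (S : Subset n) (small : ∣ S ∣ ≤ w)
         (inherit : ∀ {v} → v ∈ˢ S → Occurs P v → v ∈ˢ bag P p) where

  private
    bag′ : Node (addLeaf (tree P) p) → Subset n
    bag′ = snoc (bag P) S

  -- A vertex of S that already occurs lies in the bag of p by `inherit`, so its nodes stay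
  -- connected through the edge between p and the leaf; any other vertex of S occurs at the leaf
  -- alone.
  addBag : TreeOfBags n w
  addBag = record { tree = addLeaf (tree P) p ; bag = bag′ ; width = width′ ; conn = conn′ }
    where
    width′ : ∀ a → ∣ bag′ a ∣ ≤ w
    width′ a with view a
    ... | ‵fromℕ rewrite snoc-last (bag P) S = small
    ... | ‵inject₁ b rewrite snoc-inject₁ (bag P) S b = width P b
    old : ∀ {v b} → v ∈ˢ bag P b → v ∈ˢ bag′ (inject₁ b)
    old {v} {b} = subst (v ∈ˢ_) (≡-sym (snoc-inject₁ (bag P) S b))
    lift : ∀ {v a b} → Walk (TreeAdj (tree P)) (λ c → v ∈ˢ bag P c) a b →
           Walk (TreeAdj (addLeaf (tree P) p)) (λ c → v ∈ˢ bag′ c) (inject₁ a) (inject₁ b)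
    lift (here s) = here (old s)
    lift (step s a w) = step (old s) (inject₁-adj (tree P) p a) (lift w)
    conn′ : ∀ v → ConnectedSet (TreeAdj (addLeaf (tree P) p)) (λ a → v ∈ˢ bag′ a)
    conn′ v a b v∈a v∈b with view a | view b
    ... | ‵fromℕ | ‵fromℕ = here v∈a
    ... | ‵inject₁ a | ‵inject₁ b =
      lift (conn P v a b (subst (v ∈ˢ_) (snoc-inject₁ (bag P) S a) v∈a) (subst (v ∈ˢ_) (snoc-inject₁ (bag P) S b) v∈b))
    ... | ‵fromℕ | ‵inject₁ b
      with v∈b′ ← subst (v ∈ˢ_) (snoc-inject₁ (bag P) S b) v∈b
      = step v∈a (leaf-parent (tree P) p)
          (lift (conn P v p b (inherit (subst (v ∈ˢ_) (snoc-last (bag P) S) v∈a) (b , v∈b′)) v∈b′))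
    ... | ‵inject₁ a | ‵fromℕ
      with v∈a′ ← subst (v ∈ˢ_) (snoc-inject₁ (bag P) S a) v∈a
      with v∈p ← inherit (subst (v ∈ˢ_) (snoc-last (bag P) S) v∈b) (a , v∈a′)
      = lift (conn P v a p v∈a′ v∈p) ++ʷ step (old v∈p) (parent-leaf (tree P) p) (here v∈b)

  newNode : Node (tree addBag)
  newNode = leaf (tree P) p

  bag-newNode : bag addBag newNode ≡ S
  bag-newNode = snoc-last (bag P) S

  bag-oldNode : ∀ a → bag addBag (inject₁ a) ≡ bag P a
  bag-oldNode = snoc-inject₁ (bag P) S

  occurs-addBag : ∀ {v} → Occurs addBag v → v ∈ˢ S ⊎ Occurs P v
  occurs-addBag {v} (a , v∈) with view a
  ... | ‵fromℕ = inj₁ (subst (v ∈ˢ_) bag-newNode v∈)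
  ... | ‵inject₁ b = inj₂ (b , subst (v ∈ˢ_) (bag-oldNode b) v∈)

-- Subsets given by lists

∣p∪q∣≤∣p∣+∣q∣ : ∀ {n} (p q : Subset n) → ∣ p ∪ q ∣ ≤ ∣ p ∣ + ∣ q ∣
∣p∪q∣≤∣p∣+∣q∣ [] [] = z≤n
∣p∪q∣≤∣p∣+∣q∣ (true ∷ p) (true ∷ q) = s≤s (≤-trans (∣p∪q∣≤∣p∣+∣q∣ p q) (+-monoʳ-≤ ∣ p ∣ (n≤1+n ∣ q ∣)))
∣p∪q∣≤∣p∣+∣q∣ (true ∷ p) (false ∷ q) = s≤s (∣p∪q∣≤∣p∣+∣q∣ p q)
∣p∪q∣≤∣p∣+∣q∣ (false ∷ p) (true ∷ q) = ≤-trans (s≤s (∣p∪q∣≤∣p∣+∣q∣ p q)) (≤-reflexive (≡-sym (+-suc ∣ p ∣ ∣ q ∣)))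
∣p∪q∣≤∣p∣+∣q∣ (false ∷ p) (false ∷ q) = ∣p∪q∣≤∣p∣+∣q∣ p q

fromList : ∀ {n} → List (Fin n) → Subset n
fromList = foldr (λ v S → ⁅ v ⁆ ∪ S) ∅

∈-fromList⁺ : ∀ {n} {v : Fin n} {vs} → v ∈ vs → v ∈ˢ fromList vs
∈-fromList⁺ {vs = u ∷ vs} (here refl) = p⊆p∪q (fromList vs) (x∈⁅x⁆ u)
∈-fromList⁺ {vs = u ∷ vs} (there v∈) = q⊆p∪q ⁅ u ⁆ (fromList vs) (∈-fromList⁺ v∈)

∈-fromList⁻ : ∀ {n} {v : Fin n} vs → v ∈ˢ fromList vs → v ∈ vs
∈-fromList⁻ [] v∈ = ⊥-elim (∉⊥ v∈)
∈-fromList⁻ (u ∷ vs) v∈ with x∈p∪q⁻ ⁅ u ⁆ (fromList vs) v∈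
... | inj₁ v∈u = here (x∈⁅y⁆⇒x≡y u v∈u)
... | inj₂ v∈vs = there (∈-fromList⁻ vs v∈vs)

∣fromList∣≤length : ∀ {n} (vs : List (Fin n)) → ∣ fromList vs ∣ ≤ length vs
∣fromList∣≤length {n} [] = ≤-reflexive (∣⊥∣≡0 n)
∣fromList∣≤length (v ∷ vs) = ≤-trans (∣p∪q∣≤∣p∣+∣q∣ ⁅ v ⁆ (fromList vs))
  (+-mono-≤ (≤-reflexive (∣⁅x⁆∣≡1 v)) (∣fromList∣≤length vs))

map-proj₁-toList : {A : Set} {P : A → Set} {xs : List A} (pxs : All P xs) → map proj₁ (All.toList pxs) ≡ xs
map-proj₁-toList [] = refl
map-proj₁-toList (_ ∷ pxs) = cong (_ ∷_) (map-proj₁-toList pxs)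

∈-toList : {A : Set} {P : A → Set} {x : A} {xs : List A} (pxs : All P xs) (x∈ : x ∈ xs) →
           (x , All.lookup pxs x∈) ∈ All.toList pxs
∈-toList (_ ∷ _) (here refl) = here refl
∈-toList (_ ∷ pxs) (there x∈) = there (∈-toList pxs x∈)

-- Cutting the line of vertices into intervals

module Intervals {n : ℕ} (G : Graph n) (pos : Fin n → ℕ) (pos-injective : Injective _≡_ _≡_ pos) where

  -- An edge gives two darts, one per direction, so an edge leaving an interval can be recorded with
  -- its inner end as `source`.
  Dart : Set
  Dart = Σ (Fin n × Fin n) λ (u , v) → adj G u v ≡ true

  source target : Dart → Fin n
  source ((u , _) , _) = u
  target ((_ , v) , _) = v

  private
    adj? : Decidable (λ ((u , v) : Fin n × Fin n) → adj G u v ≡ true)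
    adj? (u , v) = adj G u v Bool.≟ true

    pairs : List (Fin n × Fin n)
    pairs = cartesianProduct (allFin n) (allFin n)

  darts : List Dart
  darts = All.toList (all-filter adj? pairs)

  dart-≡ : ∀ {δ ε : Dart} → proj₁ δ ≡ proj₁ ε → δ ≡ ε
  dart-≡ {_ , p} {_ , q} refl = cong (_ ,_) (≡-irrelevant p q)

  ∈-darts : ∀ (δ : Dart) → δ ∈ darts
  ∈-darts ((u , v) , uv) = subst (_∈ darts) (dart-≡ refl)
    (∈-toList (all-filter adj? pairs) (∈-filter⁺ adj? (∈-cartesianProduct⁺ (∈-allFin u) (∈-allFin v)) uv))

  darts-unique : Unique darts
  darts-unique = Unique.map⁻ (subst Unique (≡-sym (map-proj₁-toList (all-filter adj? pairs)))
    (Unique.filter⁺ adj? (Unique.cartesianProduct⁺ (Unique.allFin⁺ n) (Unique.allFin⁺ n))))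

  Inside Outside : ℕ → ℕ → Fin n → Set
  Inside x y v = x < pos v × pos v < y
  Outside x y v = pos v < x ⊎ y < pos v

  -- Both conditions are strict: edges to the vertices at x and y do not count, as these vertices
  -- are placed in the bags separately.
  Cut : ℕ → ℕ → Dart → Set
  Cut x y δ = Inside x y (source δ) × Outside x y (target δ)

  cut? : ∀ x y → Decidable (Cut x y)
  cut? x y δ = ((x <? pos (source δ)) ×-dec (pos (source δ) <? y)) ×-dec ((pos (target δ) <? x) ⊎-dec (y <? pos (target δ)))

  cut : ℕ → ℕ → List Dart
  cut x y = filter (cut? x y) darts

  Frontier : ℕ → ℕ → Fin n → Set
  Frontier x y v = Inside x y v × ∃ λ u → adj G v u ≡ true × Outside x y u

  frontier : ℕ → ℕ → List (Fin n)
  frontier x y = map source (cut x y)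

  ∈-frontier⁺ : ∀ {x y v} → Frontier x y v → v ∈ frontier x y
  ∈-frontier⁺ {x} {y} (in-v , u , vu , out-u) = ∈-map⁺ source (∈-filter⁺ (cut? x y) (∈-darts ((_ , u) , vu)) (in-v , out-u))

  ∈-frontier⁻ : ∀ {x y v} → v ∈ frontier x y → Frontier x y v
  ∈-frontier⁻ {x} {y} v∈ with ((_ , u) , vu) , vu∈ , refl ← ∈-map⁻ source v∈
    with _ , in-v , out-u ← ∈-filter⁻ (cut? x y) {xs = darts} vu∈ = in-v , u , vu , out-u

  Frontier-shrink : ∀ {x y x′ y′ v} → x ≤ x′ → y′ ≤ y → Inside x′ y′ v → Frontier x y v → Frontier x′ y′ v
  Frontier-shrink x≤x′ y′≤y in-v (_ , u , vu , out-u) =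
    in-v , u , vu , Sum.map (λ u<x → <-≤-trans u<x x≤x′) (λ y<u → ≤-<-trans y′≤y y<u) out-u

  -- End points of intervals are arbitrary positions and need not carry a vertex, hence a list of
  -- length at most one.
  vertexAt : ℕ → List (Fin n)
  vertexAt x with any? (λ v → pos v ≟ x)
  ... | yes (v , _) = v ∷ []
  ... | no _ = []

  ∈-vertexAt⁺ : ∀ v → v ∈ vertexAt (pos v)
  ∈-vertexAt⁺ v with any? (λ u → pos u ≟ pos v)
  ... | yes (u , eq) = here (pos-injective (≡-sym eq))
  ... | no none = ⊥-elim (none (v , refl))

  ∈-vertexAt⁻ : ∀ {x v} → v ∈ vertexAt x → pos v ≡ x
  ∈-vertexAt⁻ {x} v∈ with any? (λ u → pos u ≟ x)
  ∈-vertexAt⁻ (here refl) | yes (u , eq) = eq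
  ∈-vertexAt⁻ () | no _

  length-vertexAt : ∀ x → length (vertexAt x) ≤ 1
  length-vertexAt x with any? (λ u → pos u ≟ x)
  ... | yes _ = ≤-refl
  ... | no _ = z≤n

  vertices : ℕ → ℕ → ℕ → List (Fin n)
  vertices x y z = vertexAt x ++ vertexAt y ++ vertexAt z ++ frontier x z ++ frontier z y

  data InBag (x y z : ℕ) (v : Fin n) : Set where
    at-x : pos v ≡ x → InBag x y z v
    at-y : pos v ≡ y → InBag x y z v
    at-z : pos v ≡ z → InBag x y z v
    left-frontier : Frontier x z v → InBag x y z v
    right-frontier : Frontier z y v → InBag x y z v

  ∈-vertices⁺ : ∀ {x y z v} → InBag x y z v → v ∈ vertices x y z
  ∈-vertices⁺ (at-x refl) = ∈-++⁺ˡ (∈-vertexAt⁺ _)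
  ∈-vertices⁺ {x} (at-y refl) = ∈-++⁺ʳ (vertexAt x) (∈-++⁺ˡ (∈-vertexAt⁺ _))
  ∈-vertices⁺ {x} {y} (at-z refl) = ∈-++⁺ʳ (vertexAt x) (∈-++⁺ʳ (vertexAt y) (∈-++⁺ˡ (∈-vertexAt⁺ _)))
  ∈-vertices⁺ {x} {y} {z} (left-frontier fr) =
    ∈-++⁺ʳ (vertexAt x) (∈-++⁺ʳ (vertexAt y) (∈-++⁺ʳ (vertexAt z) (∈-++⁺ˡ (∈-frontier⁺ fr))))
  ∈-vertices⁺ {x} {y} {z} (right-frontier fr) =
    ∈-++⁺ʳ (vertexAt x) (∈-++⁺ʳ (vertexAt y) (∈-++⁺ʳ (vertexAt z) (∈-++⁺ʳ (frontier x z) (∈-frontier⁺ fr))))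

  ∈-vertices⁻ : ∀ {x y z v} → v ∈ vertices x y z → InBag x y z v
  ∈-vertices⁻ {x} {y} {z} v∈ with ∈-++⁻ (vertexAt x) v∈
  ... | inj₁ v∈x = at-x (∈-vertexAt⁻ v∈x)
  ... | inj₂ v∈ with ∈-++⁻ (vertexAt y) v∈
  ... | inj₁ v∈y = at-y (∈-vertexAt⁻ v∈y)
  ... | inj₂ v∈ with ∈-++⁻ (vertexAt z) v∈
  ... | inj₁ v∈z = at-z (∈-vertexAt⁻ v∈z)
  ... | inj₂ v∈ with ∈-++⁻ (frontier x z) v∈
  ... | inj₁ v∈l = left-frontier (∈-frontier⁻ v∈l)
  ... | inj₂ v∈r = right-frontier (∈-frontier⁻ v∈r)

  length-vertices : ∀ {K} x y z → length (cut x z) ≤ K → length (cut z y) ≤ K → length (vertices x y z) ≤ 3 + (K + K)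
  length-vertices x y z xz≤ zy≤ =
    ++-≤ (vertexAt x) (length-vertexAt x)
      (++-≤ (vertexAt y) (length-vertexAt y)
        (++-≤ (vertexAt z) (length-vertexAt z)
          (++-≤ (frontier x z) (≤-trans (≤-reflexive (length-map source (cut x z))) xz≤)
            (≤-trans (≤-reflexive (length-map source (cut z y))) zy≤))))
    where
    ++-≤ : ∀ (us : List (Fin n)) {vs k l} → length us ≤ k → length vs ≤ l → length (us ++ vs) ≤ k + l
    ++-≤ us us≤ vs≤ = ≤-trans (≤-reflexive (length-++ us)) (+-mono-≤ us≤ vs≤)

  -- Extending a tree of bags over an interval

  -- Old bags persist unchanged, so later subtrees can still be attached to them. The field
  -- `occurs-old` confines newly placed vertices to [x , y], which is what allows the right half to
  -- be added after the left one.
  record Extension {w} (P : TreeOfBags n w) (x y : ℕ) : Set where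
    field
      extended   : TreeOfBags n w
      embed      : Node (tree P) → Node (tree extended)
      bag-embed  : ∀ a → bag extended (embed a) ≡ bag P a
      occurs-old : ∀ {v} → Occurs extended v → Occurs P v ⊎ (x ≤ pos v × pos v ≤ y)
      occurs-new : ∀ {v} → Inside x y v → Occurs extended v
      together   : ∀ {u v} → adj G u v ≡ true → x ≤ pos u → pos u < pos v → pos v ≤ y → Together extended u v

    embed-∈ : ∀ {v a} → v ∈ˢ bag P a → v ∈ˢ bag extended (embed a)
    embed-∈ {v} {a} = subst (v ∈ˢ_) (≡-sym (bag-embed a))

    embed-Occurs : ∀ {v} → Occurs P v → Occurs extended v
    embed-Occurs (a , v∈) = embed a , embed-∈ v∈

    embed-Together : ∀ {u v} → Together P u v → Together extended u v
    embed-Together (a , u∈ , v∈) = embed a , embed-∈ u∈ , embed-∈ v∈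

  open Extension

  -- The bag of p holds the boundary of [x , y] and, by `old`, every interior vertex placed so far.
  -- So a bag for the split at z can hang below p, and it in turn serves as the parent for both
  -- halves.
  module Step {w x y z : ℕ} (x<z : x < z) (z<y : z < y) (size : length (vertices x y z) ≤ w)
    (P : TreeOfBags n w) (p : Node (tree P))
    (top : ∀ {v} → pos v ≡ x ⊎ pos v ≡ y ⊎ Frontier x y v → v ∈ˢ bag P p)
    (old : ∀ {v} → Inside x y v → Occurs P v → Frontier x y v) where

    private
      x<y : x < y
      x<y = <-trans x<z z<y

      S : Subset n
      S = fromList (vertices x y z)

      S≤ : ∣ S ∣ ≤ w
      S≤ = ≤-trans (∣fromList∣≤length (vertices x y z)) size

      S⁻ : ∀ {v} → v ∈ˢ S → InBag x y z v
      S⁻ = ∈-vertices⁻ ∘ ∈-fromList⁻ (vertices x y z)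

      widenˡ : ∀ {v} → Inside x z v → Inside x y v
      widenˡ (x<v , v<z) = x<v , <-trans v<z z<y

      widenʳ : ∀ {v} → Inside z y v → Inside x y v
      widenʳ (z<v , v<y) = <-trans x<z z<v , v<y

      inherit : ∀ {v} → v ∈ˢ S → Occurs P v → v ∈ˢ bag P p
      inherit v∈S occ with S⁻ v∈S
      ... | at-x eq = top (inj₁ eq)
      ... | at-y eq = top (inj₂ (inj₁ eq))
      ... | at-z refl = top (inj₂ (inj₂ (old (x<z , z<y) occ)))
      ... | left-frontier (in-v , _) = top (inj₂ (inj₂ (old (widenˡ in-v) occ)))
      ... | right-frontier (in-v , _) = top (inj₂ (inj₂ (old (widenʳ in-v) occ)))

    P₁ : TreeOfBags n w
    P₁ = addBag P p S S≤ inherit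

    p₁ : Node (tree P₁)
    p₁ = newNode P p S S≤ inherit

    p₁⁺ : ∀ {v} → InBag x y z v → v ∈ˢ bag P₁ p₁
    p₁⁺ {v} = subst (v ∈ˢ_) (≡-sym (bag-newNode P p S S≤ inherit)) ∘ ∈-fromList⁺ ∘ ∈-vertices⁺

    private
      occurs-P₁ : ∀ {v} → Occurs P₁ v → InBag x y z v ⊎ Occurs P v
      occurs-P₁ = Sum.map₁ S⁻ ∘ occurs-addBag P p S S≤ inherit

    -- Restores the invariant for the left half. In the new bag only the left frontier lies strictly
    -- between x and z; a vertex placed earlier has a neighbour outside [x , y], hence outside
    -- [x , z].
    old₁ : ∀ {v} → Inside x z v → Occurs P₁ v → Frontier x z v
    old₁ in-v@(x<v , v<z) occ with occurs-P₁ occ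
    ... | inj₂ occP = Frontier-shrink ≤-refl (<⇒≤ z<y) in-v (old (widenˡ in-v) occP)
    ... | inj₁ (at-x refl) = ⊥-elim (<-irrefl refl x<v)
    ... | inj₁ (at-y refl) = ⊥-elim (<-asym v<z z<y)
    ... | inj₁ (at-z refl) = ⊥-elim (<-irrefl refl v<z)
    ... | inj₁ (left-frontier fr) = fr
    ... | inj₁ (right-frontier ((z<v , _) , _)) = ⊥-elim (<-asym v<z z<v)

    module _ (E₁ : Extension P₁ x z) where

      -- The same for the right half once the left one is built: `occurs-old` places whatever the
      -- left half added at positions up to z.
      old₂ : ∀ {v} → Inside z y v → Occurs (extended E₁) v → Frontier z y v
      old₂ in-v@(z<v , v<y) occ with Sum.map₁ occurs-P₁ (occurs-old E₁ occ)
      ... | inj₂ (_ , v≤z) = ⊥-elim (<⇒≱ z<v v≤z)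
      ... | inj₁ (inj₂ occP) = Frontier-shrink (<⇒≤ x<z) ≤-refl in-v (old (widenʳ in-v) occP)
      ... | inj₁ (inj₁ (at-x refl)) = ⊥-elim (<-asym x<z z<v)
      ... | inj₁ (inj₁ (at-y refl)) = ⊥-elim (<-irrefl refl v<y)
      ... | inj₁ (inj₁ (at-z refl)) = ⊥-elim (<-irrefl refl z<v)
      ... | inj₁ (inj₁ (left-frontier ((_ , v<z) , _))) = ⊥-elim (<-asym v<z z<v)
      ... | inj₁ (inj₁ (right-frontier fr)) = fr

      combine : Extension (extended E₁) z y → Extension P x y
      combine E₂ = record
        { extended = extended E₂
        ; embed = λ a → embed E₂ (embed E₁ (inject₁ a))
        ; bag-embed = λ a → trans (bag-embed E₂ _) (trans (bag-embed E₁ _) (bag-oldNode P p S S≤ inherit a))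
        ; occurs-old = occurs-old′
        ; occurs-new = occurs-new′
        ; together = together′
        }
        where
        occurs-old′ : ∀ {v} → Occurs (extended E₂) v → Occurs P v ⊎ (x ≤ pos v × pos v ≤ y)
        occurs-old′ occ with Sum.map₁ (Sum.map₁ occurs-P₁ ∘ occurs-old E₁) (occurs-old E₂ occ)
        ... | inj₂ (z≤v , v≤y) = inj₂ (≤-trans (<⇒≤ x<z) z≤v , v≤y)
        ... | inj₁ (inj₂ (x≤v , v≤z)) = inj₂ (x≤v , ≤-trans v≤z (<⇒≤ z<y))
        ... | inj₁ (inj₁ (inj₂ occP)) = inj₁ occP
        ... | inj₁ (inj₁ (inj₁ (at-x refl))) = inj₂ (≤-refl , <⇒≤ x<y)
        ... | inj₁ (inj₁ (inj₁ (at-y refl))) = inj₂ (<⇒≤ x<y , ≤-refl)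
        ... | inj₁ (inj₁ (inj₁ (at-z refl))) = inj₂ (<⇒≤ x<z , <⇒≤ z<y)
        ... | inj₁ (inj₁ (inj₁ (left-frontier ((x<v , v<z) , _)))) = inj₂ (<⇒≤ x<v , <⇒≤ (<-trans v<z z<y))
        ... | inj₁ (inj₁ (inj₁ (right-frontier ((z<v , v<y) , _)))) = inj₂ (<⇒≤ (<-trans x<z z<v) , <⇒≤ v<y)
        node : Node (tree (extended E₂))
        node = embed E₂ (embed E₁ p₁)
        node⁺ : ∀ {v} → InBag x y z v → v ∈ˢ bag (extended E₂) node
        node⁺ = embed-∈ E₂ ∘ embed-∈ E₁ ∘ p₁⁺
        occurs-new′ : ∀ {v} → Inside x y v → Occurs (extended E₂) v
        occurs-new′ {v} (x<v , v<y) with <-cmp (pos v) z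
        ... | tri< v<z _ _ = embed-Occurs E₂ (occurs-new E₁ (x<v , v<z))
        ... | tri≈ _ v≡z _ = node , node⁺ (at-z v≡z)
        ... | tri> _ _ z<v = occurs-new E₂ (z<v , v<y)
        together′ : ∀ {u v} → adj G u v ≡ true → x ≤ pos u → pos u < pos v → pos v ≤ y →
                    Together (extended E₂) u v
        together′ {u} {v} uv x≤u u<v v≤y with z <? pos v | pos u <? z
        ... | no z≮v | _ = embed-Together E₂ (together E₁ uv x≤u u<v (≮⇒≥ z≮v))
        ... | yes _ | no u≮z = together E₂ uv (≮⇒≥ u≮z) u<v v≤y
        -- An edge straddling z is realised by the new bag: each end is at x or y, or lies in a
        -- frontier because the other end is across z.
        ... | yes z<v | yes u<z = node , node⁺ in-u , node⁺ in-v
          where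
          in-u : InBag x y z u
          in-u with x <? pos u
          ... | yes x<u = left-frontier ((x<u , u<z) , v , uv , inj₂ z<v)
          ... | no x≮u = at-x (≤-antisym (≮⇒≥ x≮u) x≤u)
          in-v : InBag x y z v
          in-v with pos v <? y
          ... | yes v<y = right-frontier ((z<v , v<y) , u , trans (sym G v u) uv , inj₁ u<z)
          ... | no v≮y = at-y (≤-antisym v≤y (≮⇒≥ v≮y))

  module _ (K : ℕ)
    (split : ∀ x y → suc x < y → length (cut x y) ≤ K →
             ∃ λ z → x < z × z < y × length (cut x z) ≤ K × length (cut z y) ≤ K) where

    -- The vertices of an open interval that are already in the tree are exactly those that must be
    -- inherited from p, so hanging new bags below p keeps the occurrences of a vertex connected.
    extend : ∀ fuel x y → x < y → y ≤ fuel + x → length (cut x y) ≤ K →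
             (P : TreeOfBags n (3 + (K + K))) (p : Node (tree P)) →
             (∀ {v} → pos v ≡ x ⊎ pos v ≡ y ⊎ Frontier x y v → v ∈ˢ bag P p) →
             (∀ {v} → Inside x y v → Occurs P v → Frontier x y v) →
             Extension P x y
    extend zero x y x<y y≤ = ⊥-elim (<⇒≱ x<y y≤)
    extend (suc fuel) x y x<y y≤ small P p top old with suc x <? y
    -- With no interior position, the only possible edge within [x , y] joins the vertices at x and
    -- y, which the bag of p already holds.
    ... | no x+1≮y = record
      { extended = P
      ; embed = λ a → a
      ; bag-embed = λ _ → refl
      ; occurs-old = inj₁
      ; occurs-new = λ (x<v , v<y) → ⊥-elim (x+1≮y (≤-<-trans x<v v<y))
      ; together = λ _ x≤u u<v v≤y →
          p , top (inj₁ (≤-antisym (s≤s⁻¹ (≤-trans u<v (≤-trans v≤y (≮⇒≥ x+1≮y)))) x≤u))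
            , top (inj₂ (inj₁ (≤-antisym v≤y (≤-trans (≮⇒≥ x+1≮y) (≤-<-trans x≤u u<v)))))
      }
    ... | yes x+1<y with z , x<z , z<y , xz≤ , zy≤ ← split x y x+1<y small =
      let open Step x<z z<y (length-vertices x y z xz≤ zy≤) P p top old
          E₁ = extend fuel x z x<z (s≤s⁻¹ (≤-trans z<y y≤)) xz≤ P₁ p₁
                 [ p₁⁺ ∘ at-x , [ p₁⁺ ∘ at-z , p₁⁺ ∘ left-frontier ]′ ]′ old₁
      in combine E₁
           (extend fuel z y z<y
             (≤-trans y≤ (≤-trans (≤-reflexive (≡-sym (+-suc fuel x))) (+-monoʳ-≤ fuel x<z))) zy≤
             (extended E₁) (embed E₁ p₁)
             (embed-∈ E₁ ∘ [ p₁⁺ ∘ at-z , [ p₁⁺ ∘ at-y , p₁⁺ ∘ right-frontier ]′ ]′) (old₂ E₁))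

    -- The recursion starts from [0 , `suc M`], which contains all vertices and so has an empty cut.
    -- The end `suc M` keeps the interval non-degenerate even for M = 0 and carries no vertex, so
    -- the root bag only has to hold the vertex at 0, if any.
    treeDecomposition : ∀ M → (∀ v → pos v < M) → TreeDecomposition G (2 + (K + K))
    treeDecomposition M pos<M = record
      { tree = tree T
      ; bag = bag T
      ; width = width T
      ; cover = cover′
      ; edges = edges′
      ; conn = conn T
      }
      where
      root-≤ : ∣ fromList (vertexAt 0) ∣ ≤ 3 + (K + K)
      root-≤ = ≤-trans (∣fromList∣≤length (vertexAt 0)) (≤-trans (length-vertexAt 0) (s≤s z≤n))
      root : TreeOfBags n (3 + (K + K))
      root = singleBag (fromList (vertexAt 0)) root-≤
      at-root : ∀ {v} → pos v ≡ 0 → v ∈ˢ fromList (vertexAt 0)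
      at-root {v} eq = ∈-fromList⁺ (subst (λ q → v ∈ vertexAt q) eq (∈-vertexAt⁺ v))
      nothing-outside : ∀ {v} → ¬ Outside 0 (suc M) v
      nothing-outside {v} (inj₂ M<v) = <-asym (pos<M v) (<-trans (n<1+n M) M<v)
      no-cut : length (cut 0 (suc M)) ≤ K
      no-cut with cut 0 (suc M) in eq
      ... | [] = z≤n
      ... | d ∷ _ = ⊥-elim (nothing-outside (proj₂ (proj₂ (∈-filter⁻ (cut? 0 (suc M)) {v = d} {xs = darts} (subst (d ∈_) (≡-sym eq) (here refl))))))
      E : Extension root 0 (suc M)
      E = extend (suc M) 0 (suc M) (s≤s z≤n) (≤-reflexive (≡-sym (+-identityʳ (suc M)))) no-cut root fzero
        (λ { (inj₁ v≡0) → at-root v≡0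
           ; (inj₂ (inj₁ v≡M)) → ⊥-elim (<-asym (subst (_< M) v≡M (pos<M _)) (n<1+n M))
           ; (inj₂ (inj₂ (_ , u , _ , out-u))) → ⊥-elim (nothing-outside out-u) })
        (λ { (0<v , _) (_ , v∈) → ⊥-elim (<⇒≢ 0<v (≡-sym (∈-vertexAt⁻ (∈-fromList⁻ (vertexAt 0) v∈)))) })
      T = extended E
      cover′ : ∀ v → Occurs T v
      cover′ v with pos v ≟ 0
      ... | yes v≡0 = embed-Occurs E (fzero , at-root v≡0)
      ... | no v≢0 = occurs-new E (n≢0⇒n>0 v≢0 , m<n⇒m<1+n (pos<M v))
      edges′ : ∀ u v → adj G u v ≡ true → Together T u v
      edges′ u v uv with <-cmp (pos u) (pos v)
      ... | tri< u<v _ _ = together E uv z≤n u<v (<⇒≤ (m<n⇒m<1+n (pos<M v)))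
      ... | tri> _ _ v<u with a , v∈ , u∈ ← together E (trans (sym G v u) uv) z≤n v<u (<⇒≤ (m<n⇒m<1+n (pos<M u))) = a , u∈ , v∈
      ... | tri≈ _ u≡v _ with refl ← pos-injective u≡v = case trans (≡-sym uv) (irrfl G u) of λ ()

-- Chords and crossings

unique-⊆⇒length≤ : {A : Set} {xs ys : List A} → Unique xs → (∀ {x} → x ∈ xs → x ∈ ys) → length xs ≤ length ys
unique-⊆⇒length≤ {xs = []} _ _ = z≤n
unique-⊆⇒length≤ {xs = x ∷ xs} {ys} (x∉ ∷ uniq) sub with zs , ys↭ ← ∈⇒↭∷ (sub (here refl)) =
  ≤-trans (s≤s (unique-⊆⇒length≤ uniq sub′)) (≤-reflexive (≡-sym (↭-length ys↭)))
  where
  sub′ : ∀ {z} → z ∈ xs → z ∈ zs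
  sub′ z∈ with ∈-resp-↭ ys↭ (sub (there z∈))
  ... | here refl = ⊥-elim (All.lookup x∉ z∈ refl)
  ... | there z∈zs = z∈zs

-- Sort and cut after d entries. Applied to the leaving edges with the positions of their inner ends
-- as keys, it decides which are extended to x and which to y.
split-by-key : {A : Set} (key : A → ℕ) (d : ℕ) (xs : List A) → length xs ≤ d + d →
               ∃₂ λ as bs → (as ++ bs ↭ xs) × length as ≤ d × length bs ≤ d ×
                            (∀ {a b} → a ∈ as → b ∈ bs → key a ≤ key b)
split-by-key {A} key d xs small =
  take d ys , drop d ys , subst (_↭ xs) (≡-sym (take++drop≡id d ys)) (sort-↭ xs) ,
  ≤-trans (≤-reflexive (length-take d ys)) (m⊓n≤m d (length ys)) ,
  ≤-trans (≤-reflexive (length-drop d ys)) (m≤n+o⇒m∸n≤o (length ys) d (≤-trans (≤-reflexive (↭-length (sort-↭ xs))) small)) ,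
  AllPairs-++⁻ (take d ys) (subst (AllPairs _) (≡-sym (take++drop≡id d ys)) (Sorted.Sorted⇒AllPairs (DecTotalOrder.totalOrder order) (sort-↗ xs)))
  where
  order : DecTotalOrder _ _ _
  order = On.decTotalOrder ≤-decTotalOrder key
  open Sort order using (sort; sort-↭; sort-↗)
  ys : List A
  ys = sort xs

module Chords {n : ℕ} (G : Graph n) (D : CircularDrawing n) where

  private
    pos : Fin n → ℕ
    pos = proj₁ D

    pos-injective : Injective _≡_ _≡_ pos
    pos-injective = proj₂ D

  open Intervals G pos pos-injective public

  -- The condition in `Cross`, freed from the index order imposed by `Edge`, so that the ends of
  -- either chord can be swapped.
  VertexCross : Fin n × Fin n → Fin n × Fin n → Set
  VertexCross (a , b) (c , d) =
    (c ≢ a) × (c ≢ b) × (d ≢ a) × (d ≢ b) ×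
    ((StrictlyBetween (pos a) (pos b) (pos c) × ¬ StrictlyBetween (pos a) (pos b) (pos d))
     ⊎ (¬ StrictlyBetween (pos a) (pos b) (pos c) × StrictlyBetween (pos a) (pos b) (pos d)))

  VertexCross-swapˡ : ∀ {p q} → VertexCross p q → VertexCross (swap p) q
  VertexCross-swapˡ {a , b} (c≢a , c≢b , d≢a , d≢b , separated)
    rewrite ⊓-comm (pos a) (pos b) | ⊔-comm (pos a) (pos b) = c≢b , c≢a , d≢b , d≢a , separated

  VertexCross-swapʳ : ∀ {p q} → VertexCross p q → VertexCross p (swap q)
  VertexCross-swapʳ (c≢a , c≢b , d≢a , d≢b , separated) =
    d≢a , d≢b , c≢a , c≢b , Sum.swap (Sum.map swap swap separated)

  separated⇒VertexCross : ∀ {a b c d} → Inside (pos a) (pos b) c → Outside (pos a) (pos b) d →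
                          VertexCross (a , b) (c , d)
  separated⇒VertexCross {a} {b} {c} {d} (a<c , c<b) out-d =
    (λ { refl → <-irrefl refl a<c }) , (λ { refl → <-irrefl refl c<b }) ,
    (λ { refl → [ <-irrefl refl , <-asym a<b ]′ out-d }) ,
    (λ { refl → [ <-asym a<b , <-irrefl refl ]′ out-d }) ,
    inj₁ (between , not-between)
    where
    a<b : pos a < pos b
    a<b = <-trans a<c c<b
    between : StrictlyBetween (pos a) (pos b) (pos c)
    between rewrite m≤n⇒m⊓n≡m (<⇒≤ a<b) | m≤n⇒m⊔n≡n (<⇒≤ a<b) = a<c , c<b
    not-between : ¬ StrictlyBetween (pos a) (pos b) (pos d)
    not-between rewrite m≤n⇒m⊓n≡m (<⇒≤ a<b) | m≤n⇒m⊔n≡n (<⇒≤ a<b) =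
      λ (a<d , d<b) → [ <-asym a<d , <-asym d<b ]′ out-d

  -- Crossing is symmetric, though `Cross` is not visibly so: if d lies before a, then a is inside
  -- and b outside the interval from d to c; if d lies after b, then b is inside and a outside the
  -- interval from c to d.
  separated⇒VertexCross′ : ∀ {a b c d} → Inside (pos a) (pos b) c → Outside (pos a) (pos b) d →
                           VertexCross (c , d) (a , b)
  separated⇒VertexCross′ {a} {b} {c} {d} (a<c , c<b) (inj₁ d<a) =
    VertexCross-swapˡ {d , c} (separated⇒VertexCross (d<a , a<c) (inj₂ c<b))
  separated⇒VertexCross′ {a} {b} {c} {d} (a<c , c<b) (inj₂ b<d) =
    VertexCross-swapʳ {c , d} {b , a} (separated⇒VertexCross (c<b , b<d) (inj₁ a<c))

  -- An `Edge` lists its ends by vertex index, which is unrelated to the order of their positions.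
  edge : Dart → Edge G
  edge ((u , v) , uv) with <-cmp (toℕ u) (toℕ v)
  ... | tri< u<v _ _ = (u , v) , u<v , uv
  ... | tri> _ _ v<u = (v , u) , v<u , trans (sym G v u) uv
  ... | tri≈ _ u≡v _ with refl ← toℕ-injective u≡v = case trans (≡-sym uv) (irrfl G u) of λ ()

  edge-ends : ∀ δ → proj₁ (edge δ) ≡ proj₁ δ ⊎ proj₁ (edge δ) ≡ swap (proj₁ δ)
  edge-ends ((u , v) , uv) with <-cmp (toℕ u) (toℕ v)
  ... | tri< _ _ _ = inj₁ refl
  ... | tri> _ _ _ = inj₂ refl
  ... | tri≈ _ u≡v _ with refl ← toℕ-injective u≡v = case trans (≡-sym uv) (irrfl G u) of λ ()

  edge-cross : ∀ δ ε → VertexCross (proj₁ δ) (proj₁ ε) → Cross G D (edge δ) (edge ε)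
  edge-cross δ ε cr with edge-ends δ | edge-ends ε
  ... | inj₁ p | inj₁ q = subst₂ VertexCross (≡-sym p) (≡-sym q) cr
  ... | inj₁ p | inj₂ q = subst₂ VertexCross (≡-sym p) (≡-sym q) (VertexCross-swapʳ cr)
  ... | inj₂ p | inj₁ q = subst₂ VertexCross (≡-sym p) (≡-sym q) (VertexCross-swapˡ cr)
  ... | inj₂ p | inj₂ q = subst₂ VertexCross (≡-sym p) (≡-sym q) (VertexCross-swapʳ (VertexCross-swapˡ cr))

  edges-cross : ∀ δ ε → Inside (pos (source δ)) (pos (target δ)) (source ε) →
                Outside (pos (source δ)) (pos (target δ)) (target ε) →
                Cross G D (edge δ) (edge ε) × Cross G D (edge ε) (edge δ)
  edges-cross δ ε in-s out-t =
    edge-cross δ ε (separated⇒VertexCross in-s out-t) , edge-cross ε δ (separated⇒VertexCross′ in-s out-t)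

  flip : Dart → Dart
  flip ((u , v) , uv) = (v , u) , trans (sym G v u) uv

  edge-≡ : ∀ δ ε → edge δ ≡ edge ε → δ ≡ ε ⊎ δ ≡ flip ε
  edge-≡ δ ε eq with edge-ends δ | edge-ends ε
  ... | inj₁ p | inj₁ q = inj₁ (dart-≡ (trans (≡-sym p) (trans (cong proj₁ eq) q)))
  ... | inj₁ p | inj₂ q = inj₂ (dart-≡ (trans (≡-sym p) (trans (cong proj₁ eq) q)))
  ... | inj₂ p | inj₁ q = inj₂ (dart-≡ (cong swap (trans (≡-sym p) (trans (cong proj₁ eq) q))))
  ... | inj₂ p | inj₂ q = inj₁ (dart-≡ (cong swap (trans (≡-sym p) (trans (cong proj₁ eq) q))))

  Within : ℕ → ℕ → Dart → Set
  Within x y δ = x ≤ pos (source δ) × pos (source δ) < pos (target δ) × pos (target δ) ≤ y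

  -- Excludes the edge from x to y, which alone would cover the whole interior and violate `proper`.
  -- It belongs to no cut of either half, whose darts start at interior positions.
  Inner : ℕ → ℕ → Dart → Set
  Inner x y δ = Within x y δ × (x < pos (source δ) ⊎ pos (target δ) < y)

  inner? : ∀ x y → Decidable (Inner x y)
  inner? x y δ =
    ((x ≤? pos (source δ)) ×-dec (pos (source δ) <? pos (target δ)) ×-dec (pos (target δ) ≤? y))
    ×-dec ((x <? pos (source δ)) ⊎-dec (pos (target δ) <? y))

  Within⇒¬Cut : ∀ {x y δ} → Within x y δ → ¬ Cut x y δ
  Within⇒¬Cut (x≤s , s<t , t≤y) (_ , inj₁ t<x) = <⇒≱ (<-trans s<t t<x) x≤s
  Within⇒¬Cut (x≤s , s<t , t≤y) (_ , inj₂ y<t) = <⇒≱ y<t t≤y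

  -- At most one of the two darts of an edge labels an arc: darts within [x , y] point to the right,
  -- cut darts point from inside to outside, and no edge is of both kinds. This makes `edge`
  -- injective on the labels.
  flip-clash : ∀ {x y} δ → Within x y δ ⊎ Cut x y δ → ¬ (Within x y (flip δ) ⊎ Cut x y (flip δ))
  flip-clash _ (inj₁ (_ , s<t , _)) (inj₁ (_ , t<s , _)) = <-asym s<t t<s
  flip-clash _ (inj₁ (x≤s , s<t , t≤y)) (inj₂ (_ , out-s)) = [ (λ s<x → <⇒≱ s<x x≤s) , (λ y<s → <⇒≱ y<s (≤-trans (<⇒≤ s<t) t≤y)) ]′ out-s
  flip-clash _ (inj₂ (_ , out-t)) (inj₁ (x≤t , t<s , s≤y)) = [ (λ t<x → <⇒≱ t<x x≤t) , (λ y<t → <⇒≱ y<t (≤-trans (<⇒≤ t<s) s≤y)) ]′ out-t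
  flip-clash _ (inj₂ ((x<s , s<y) , _)) (inj₂ (_ , out-s)) = [ <-asym x<s , <-asym s<y ]′ out-s

  -- Splitting a thin interval

  module _ (d : ℕ) (no-minor : ¬ HasCompleteMinor (suc d) (Cross G D)) where

    split : ∀ x y → suc x < y → length (cut x y) ≤ d + d →
            ∃ λ z → x < z × z < y × length (cut x z) ≤ d + d × length (cut z y) ≤ d + d
    split x y x+1<y small
      with A , B , AB↭ , A≤d , B≤d , A≤B ← split-by-key (pos ∘ source) d (cut x y) small
      = answer
      where
      inner : List Dart
      inner = filter (inner? x y) darts
      innerArc leftArc rightArc : Dart → Arc Dart
      innerArc δ = arc δ (pos (source δ)) (pos (target δ))
      leftArc δ = arc δ x (pos (source δ))
      rightArc δ = arc δ (pos (source δ)) y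

      F : List (Arc Dart)
      F = map innerArc inner ++ map leftArc A ++ map rightArc B

      data Origin : Arc Dart → Set where
        from-inner : ∀ {δ} → Inner x y δ → Origin (innerArc δ)
        from-left  : ∀ {δ} → δ ∈ A → Cut x y δ → Origin (leftArc δ)
        from-right : ∀ {δ} → δ ∈ B → Cut x y δ → Origin (rightArc δ)

      cut⁻ : ∀ {δ} → δ ∈ A ++ B → Cut x y δ
      cut⁻ δ∈ = proj₂ (∈-filter⁻ (cut? x y) {xs = darts} (∈-resp-↭ AB↭ δ∈))

      origin : ∀ {α} → α ∈ F → Origin α
      origin α∈ with ∈-++⁻ (map innerArc inner) α∈
      ... | inj₁ α∈ with δ , δ∈ , refl ← ∈-map⁻ innerArc α∈ = from-inner (proj₂ (∈-filter⁻ (inner? x y) {xs = darts} δ∈))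
      ... | inj₂ α∈ with ∈-++⁻ (map leftArc A) α∈
      ... | inj₁ α∈ with δ , δ∈ , refl ← ∈-map⁻ leftArc α∈ = from-left δ∈ (cut⁻ (∈-++⁺ˡ δ∈))
      ... | inj₂ α∈ with δ , δ∈ , refl ← ∈-map⁻ rightArc α∈ = from-right δ∈ (cut⁻ (∈-++⁺ʳ A δ∈))

      inner∈F : ∀ {δ} → Inner x y δ → innerArc δ ∈ F
      inner∈F {δ} inn = ∈-++⁺ˡ (∈-map⁺ innerArc (∈-filter⁺ (inner? x y) (∈-darts δ) inn))
      left∈F : ∀ {δ} → δ ∈ A → leftArc δ ∈ F
      left∈F δ∈ = ∈-++⁺ʳ (map innerArc inner) (∈-++⁺ˡ (∈-map⁺ leftArc δ∈))
      right∈F : ∀ {δ} → δ ∈ B → rightArc δ ∈ F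
      right∈F δ∈ = ∈-++⁺ʳ (map innerArc inner) (∈-++⁺ʳ (map leftArc A) (∈-map⁺ rightArc δ∈))

      chords-F : map Arc.chord F ≡ inner ++ A ++ B
      chords-F = trans (map-++ Arc.chord (map innerArc inner) _)
        (cong₂ _++_ (chords-map innerArc (λ _ → refl) inner) (trans (map-++ Arc.chord (map leftArc A) _)
          (cong₂ _++_ (chords-map leftArc (λ _ → refl) A) (chords-map rightArc (λ _ → refl) B))))
        where
        chords-map : (f : Dart → Arc Dart) → (∀ δ → Arc.chord (f δ) ≡ δ) → ∀ δs → map Arc.chord (map f δs) ≡ δs
        chords-map f eq [] = refl
        chords-map f eq (δ ∷ δs) = cong₂ _∷_ (eq δ) (chords-map f eq δs)

      unique-F : Unique (map Arc.chord F)
      unique-F = subst Unique (≡-sym chords-F)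
        (Unique.++⁺ (Unique.filter⁺ (inner? x y) darts-unique)
          (Unique-resp-↭ (↭-sym AB↭) (Unique.filter⁺ (cut? x y) darts-unique))
          λ { {δ} (δ∈ , δ∈′) → Within⇒¬Cut {δ = δ} (proj₁ (proj₂ (∈-filter⁻ (inner? x y) {xs = darts} δ∈))) (cut⁻ δ∈′) })

      kind : ∀ {α} → Origin α → Within x y (Arc.chord α) ⊎ Cut x y (Arc.chord α)
      kind (from-inner inn) = inj₁ (proj₁ inn)
      kind (from-left _ c) = inj₂ c
      kind (from-right _ c) = inj₂ c

      edge-injective : ∀ {α β} → α ∈ F → β ∈ F → edge (Arc.chord α) ≡ edge (Arc.chord β) → Arc.chord α ≡ Arc.chord β
      edge-injective {α} {β} α∈ β∈ eq with edge-≡ (Arc.chord α) (Arc.chord β) eq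
      ... | inj₁ same = same
      ... | inj₂ flipped = ⊥-elim (flip-clash (Arc.chord β) (kind (origin β∈))
              (subst (λ δ → Within x y δ ⊎ Cut x y δ) flipped (kind (origin α∈))))

      crossing : CrossingFamily (Cross G D) edge F
      crossing α∈ β∈ = cross (origin α∈) (origin β∈)
        where
        beyond : ∀ {v δ} → Within x y δ → Outside x y v → Outside (pos (source δ)) (pos (target δ)) v
        beyond (x≤s , _ , t≤y) = Sum.map (λ v<x → <-≤-trans v<x x≤s) (λ y<v → ≤-<-trans t≤y y<v)
        cross : ∀ {α β} → Origin α → Origin β → Arc.left α < Arc.left β → Arc.left β < Arc.right α →
                Arc.right α < Arc.right β →
                Cross G D (edge (Arc.chord α)) (edge (Arc.chord β)) × Cross G D (edge (Arc.chord β)) (edge (Arc.chord α))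
        -- When an inner arc overlaps an extended one, the true inner end of the leaving edge lies
        -- under the inner arc and its other end lies beyond [x , y], so the actual chords cross.
        cross (from-inner {δ} _) (from-inner {ε} _) l<l l<r r<r = edges-cross δ ε (l<l , l<r) (inj₂ r<r)
        cross (from-inner {δ} (win , _)) (from-right {ε} _ (_ , out)) l<l l<r r<r =
          edges-cross δ ε (l<l , l<r) (beyond {δ = δ} win out)
        cross (from-left {δ} _ (_ , out)) (from-inner {ε} (win , _)) l<l l<r r<r =
          swap (edges-cross ε δ (l<r , r<r) (beyond {δ = ε} win out))
        -- By the sorting, arcs extended to x end no later than arcs extended to y begin. The
        -- remaining cases contradict the order of the end points.
        cross (from-left δ∈ _) (from-right ε∈ _) l<l l<r r<r = ⊥-elim (<⇒≱ l<r (A≤B δ∈ ε∈))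
        cross (from-left _ _) (from-left _ _) l<l _ _ = ⊥-elim (<-irrefl refl l<l)
        cross (from-inner ((x≤s , _) , _)) (from-left _ _) l<l _ _ = ⊥-elim (<⇒≱ l<l x≤s)
        cross (from-right _ _) (from-inner ((_ , _ , t≤y) , _)) _ _ r<r = ⊥-elim (<⇒≱ r<r t≤y)
        cross (from-right _ _) (from-left _ ((_ , s<y) , _)) _ _ r<r = ⊥-elim (<-asym r<r s<y)
        cross (from-right _ _) (from-right _ _) _ _ r<r = ⊥-elim (<-irrefl refl r<r)

      proper : ∀ {α} → α ∈ F → Arc.left α ≤ x → Arc.right α < y
      proper α∈ l≤x with origin α∈
      ... | from-inner (_ , inj₁ x<s) = ⊥-elim (<⇒≱ x<s l≤x)
      ... | from-inner (_ , inj₂ t<y) = t<y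
      ... | from-left _ ((_ , s<y) , _) = s<y
      ... | from-right _ ((x<s , _) , _) = ⊥-elim (<⇒≱ x<s l≤x)

      -- The bounded search makes the point explicit: if it fails, every interior point has depth at
      -- least `suc d`, which yields the excluded minor.
      shallow-point : ∃ λ z → suc x ≤ z × z < y × depth F z ≤ d
      shallow-point with anyUpTo? (λ z → (suc x ≤? z) ×-dec (depth F z ≤? d)) y
      ... | yes (z , z<y , x<z , shallow) = z , x<z , z<y , shallow
      ... | no none = ⊥-elim (no-minor (deep-family⇒minor (Cross G D) edge (suc d) F x+1<y unique-F
              edge-injective crossing proper (λ p x<p p<y → ≰⇒> λ shallow → none (p , p<y , x<p , shallow))))

      -- A cut has no repeated darts, so containment in a list bounds its length: at most d entries
      -- come from the arcs over z and at most d from C, which will be A or B.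
      bound : ∀ {z a b} (f : Arc Dart → Dart) {C : List Dart} → depth F z ≤ d → length C ≤ d →
              (∀ {δ} → Cut a b δ → δ ∈ map f (filter (covers? z) F) ++ C) → length (cut a b) ≤ d + d
      bound {z} {a} {b} f {C} shallow C≤d sub =
        ≤-trans (unique-⊆⇒length≤ (Unique.filter⁺ (cut? a b) darts-unique)
                  (λ δ∈ → sub (proj₂ (∈-filter⁻ (cut? a b) {xs = darts} δ∈))))
        (≤-trans (≤-reflexive (length-++ (map f (filter (covers? z) F))))
          (+-mono-≤ (≤-trans (≤-reflexive (length-map f (filter (covers? z) F))) shallow) C≤d))

      in-AB : ∀ {δ} → Cut x y δ → δ ∈ A ⊎ δ ∈ B
      in-AB {δ} c = ∈-++⁻ A (∈-resp-↭ (↭-sym AB↭) (∈-filter⁺ (cut? x y) (∈-darts δ) c))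

      answer : ∃ λ z → x < z × z < y × length (cut x z) ≤ d + d × length (cut z y) ≤ d + d
      answer with z , x<z , z<y , shallow ← shallow-point =
        z , x<z , z<y , bound Arc.chord shallow A≤d left-cut , bound inward shallow B≤d right-cut
        where
        covering : ∀ {α} → α ∈ F → Covers z α → ∀ (f : Arc Dart → Dart) {δ C} → f α ≡ δ →
                   δ ∈ map f (filter (covers? z) F) ++ C
        covering α∈ cov f refl = ∈-++⁺ˡ (∈-map⁺ f (∈-filter⁺ (covers? z) α∈ cov))

        -- A dart leaving [x , y] from left of z is in A, or is in B and then its arc runs from
        -- before z to y, so over z. Darts ending between z and y are inner arcs over z.
        leavingˡ : ∀ {δ} → pos (source δ) < z → Cut x y δ → δ ∈ map Arc.chord (filter (covers? z) F) ++ A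
        leavingˡ s<z c with in-AB c
        ... | inj₁ δ∈A = ∈-++⁺ʳ _ δ∈A
        ... | inj₂ δ∈B = covering (right∈F δ∈B) (s<z , z<y) Arc.chord refl

        left-cut : ∀ {δ} → Cut x z δ → δ ∈ map Arc.chord (filter (covers? z) F) ++ A
        left-cut ((x<s , s<z) , inj₁ t<x) = leavingˡ s<z ((x<s , <-trans s<z z<y) , inj₁ t<x)
        left-cut {δ} ((x<s , s<z) , inj₂ z<t) with y <? pos (target δ)
        ... | yes y<t = leavingˡ s<z ((x<s , <-trans s<z z<y) , inj₂ y<t)
        ... | no y≮t = covering (inner∈F ((<⇒≤ x<s , <-trans s<z z<t , ≮⇒≥ y≮t) , inj₁ x<s)) (s<z , z<t) Arc.chord refl

        -- Inner darts point to the right, so those entering (z , y) have to be reversed.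
        inward : Arc Dart → Dart
        inward (arc δ _ _) with z <? pos (source δ)
        ... | yes _ = δ
        ... | no _ = flip δ

        inward-yes : ∀ {δ l r} → z < pos (source δ) → inward (arc δ l r) ≡ δ
        inward-yes {δ} z<s with z <? pos (source δ)
        ... | yes _ = refl
        ... | no z≮s = ⊥-elim (z≮s z<s)

        inward-no : ∀ {δ l r} → pos (target δ) < z → inward (arc (flip δ) l r) ≡ δ
        inward-no {δ} t<z with z <? pos (target δ)
        ... | yes z<t = ⊥-elim (<-asym t<z z<t)
        ... | no _ = dart-≡ refl

        -- The mirror image: from right of z, darts of A have arcs from x past z, and those of B are
        -- counted in the second summand.
        leavingʳ : ∀ {δ} → z < pos (source δ) → Cut x y δ → δ ∈ map inward (filter (covers? z) F) ++ B
        leavingʳ {δ} z<s c with in-AB c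
        ... | inj₁ δ∈A = covering (left∈F δ∈A) (x<z , z<s) inward (inward-yes z<s)
        ... | inj₂ δ∈B = ∈-++⁺ʳ _ δ∈B

        right-cut : ∀ {δ} → Cut z y δ → δ ∈ map inward (filter (covers? z) F) ++ B
        right-cut ((z<s , s<y) , inj₂ y<t) = leavingʳ z<s ((<-trans x<z z<s , s<y) , inj₂ y<t)
        right-cut {δ} ((z<s , s<y) , inj₁ t<z) with pos (target δ) <? x
        ... | yes t<x = leavingʳ z<s ((<-trans x<z z<s , s<y) , inj₁ t<x)
        ... | no t≮x = covering (inner∈F {flip δ} ((≮⇒≥ t≮x , <-trans t<z z<s , <⇒≤ s<y) , inj₂ s<y)) (t<z , z<s) inward (inward-no t<z)

-- The numerical bound

upper-bound : ∀ {n} (f : Fin n → ℕ) → ∃ λ M → ∀ v → f v < M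
upper-bound {zero} f = 0 , λ ()
upper-bound {suc n} f with M , f<M ← upper-bound (f ∘ fsuc) =
  suc (f fzero) ⊔ M , λ { fzero → m≤m⊔n (suc (f fzero)) M ; (fsuc v) → ≤-trans (f<M v) (m≤n⊔m (suc (f fzero)) M) }

widen : ∀ {n k l} {G : Graph n} → k ≤ l → TreeDecomposition G k → TreeDecomposition G l
widen k≤l T = record
  { tree = T.tree ; bag = T.bag ; width = λ x → ≤-trans (T.width x) (s≤s k≤l)
  ; cover = T.cover ; edges = T.edges ; conn = T.conn }
  where module T = TreeDecomposition T

theorem3 : (t : ℕ) → 3 ≤ t → ∀ {n} (G : Graph n) →
    Σ (CircularDrawing n) (λ D → ¬ HasCompleteMinor t (Cross G D)) →
    TreewidthAtMost G (12 * t ∸ 23)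
theorem3 (suc (suc (suc e))) (s≤s (s≤s (s≤s z≤n))) G (D , no-minor) with M , pos<M ← upper-bound (proj₁ D) =
  widen bound (treeDecomposition (d + d) (split d no-minor) M pos<M)
  where
  open Chords G D
  d = 2 + e
  -- With t = 3 + e and d = t - 1 the width obtained is 4d + 2, and 12t - 23 exceeds it by 3 + 8e.
  -- Stating this additively avoids truncated subtraction in the ring solver.
  expand : ∀ e → 12 * (3 + e) ≡ 23 + ((2 + ((2 + e + (2 + e)) + (2 + e + (2 + e)))) + (3 + 8 * e))
  expand = solve-∀
  bound : 2 + ((d + d) + (d + d)) ≤ 12 * (3 + e) ∸ 23
  bound = ≤-trans (m≤m+n _ (3 + 8 * e)) (≤-reflexive (≡-sym (trans (cong (_∸ 23) (expand e)) (m+n∸m≡n 23 _))))
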